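{- For any integer $c\geq 1$ there is a graph $G$ with girth $6$, feedback vertex number at most $7$, and $\mathrm{tw}(G)\leq \mathrm{pw}(G)\leq 8$, such that $G$ has no $2$-colouring with clustering $c$.
   Context: Graphs are finite, simple and undirected. The girth of a graph is the length of its shortest cycle. The feedback vertex number of a graph $G$ is the minimum size of a set $A\subseteq V(G)$ such that $G-A$ is a forest. $\mathrm{tw}(G)$ and $\mathrm{pw}(G)$ denote the treewidth and pathwidth of $G$ (the minimum over tree-decompositions, respectively path-decompositions, of the maximum bag size minus one). A $2$-colouring assigns one of at most two colours to each vertex (not necessarily properly). A monochromatic component is a connected component of the subgraph induced by all vertices of a single colour. A colouring has clustering $c$ if every monochromatic component has at most $c$ vertices. -}

module Defs where

open import Data.Fin using (Fin; toℕ)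
open import Data.List using (List; []; _∷_; _++_; length)
open import Data.List.Relation.Unary.All using (All)
open import Data.List.Relation.Unary.Linked using (Linked)
open import Data.List.Relation.Unary.Unique.Propositional using (Unique)
open import Data.Nat using (ℕ; suc; _≤_)
open import Data.Nat.Properties using (1+n≢n)
open import Data.Product using (Σ-syntax; ∃-syntax; _×_)
open import Data.Refinement.Base using (Refinement-syntax; value)
open import Data.Sum using (_⊎_; inj₁; inj₂; swap)
open import Function using (_↔_)
open import Level using (0ℓ)
open import Relation.Binary using (Rel; Symmetric; Irreflexive; Decidable)
open import Relation.Binary.Construct.Closure.ReflexiveTransitive using (Star)
open import Relation.Binary.PropositionalEquality using (_≡_; refl; cong)
open import Relation.Nullary using (¬_)
open import Relation.Unary using (Pred; _∈_; ∁)

record Graph : Set₁ where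
  infix 4 _∼_
  field
    Vertex : Set
    _∼_    : Rel Vertex 0ℓ
    sym    : Symmetric _∼_
    irrefl : Irreflexive _≡_ _∼_

open Graph public using (Vertex)

record IsFinite (G : Graph) : Set where
  open Graph G using (_∼_)
  field
    order       : ℕ
    enumeration : Vertex G ↔ Fin order
    _∼?_        : Decidable _∼_

VertexSet : Graph → Set₁
VertexSet G = Pred (Vertex G) 0ℓ

-- Membership proofs in the refinement type are irrelevant, so the vertices
-- of the induced subgraph are distinct exactly when they are distinct in G.
induced : (G : Graph) → VertexSet G → Graph
induced G S = record
  { Vertex = [ v ∈ Vertex G ∣ v ∈ S ]
  ; _∼_    = λ u v → value u ∼ value v
  ; sym    = sym
  ; irrefl = λ u≡v → irrefl (cong value u≡v)
  }
  where open Graph G using (_∼_; sym; irrefl)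

infixl 6 _─_
_─_ : (G : Graph) → VertexSet G → Graph
G ─ A = induced G (∁ A)

-- |P| ≤ k, for a set given by a predicate.
AtMost : {X : Set} → ℕ → Pred X 0ℓ → Set
AtMost k P = ∀ xs → Unique xs → All P xs → length xs ≤ k

Component : (G : Graph) → Vertex G → VertexSet G
Component G v u = Star (Graph._∼_ G) v u

Connected : Graph → Set
Connected G = ∀ u v → u ∈ Component G v

record Cycle (G : Graph) (k : ℕ) : Set where
  open Graph G using (_∼_)
  field
    start    : Vertex G
    rest     : List (Vertex G)
    length≡k : length (start ∷ rest) ≡ k
    3≤k      : 3 ≤ k
    distinct : Unique (start ∷ rest)
    closed   : Linked _∼_ (start ∷ rest ++ start ∷ [])

HasGirth : Graph → ℕ → Set
HasGirth G g = Cycle G g × (∀ k → Cycle G k → g ≤ k)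

IsForest : Graph → Set
IsForest G = ∀ k → ¬ Cycle G k

record IsTree (T : Graph) : Set where
  field
    finite    : IsFinite T
    nonempty  : Vertex T
    connected : Connected T
    forest    : IsForest T

-- The path with m + 1 vertices.
path : ℕ → Graph
path m = record
  { Vertex = Fin (suc m)
  ; _∼_    = λ i j → suc (toℕ i) ≡ toℕ j ⊎ suc (toℕ j) ≡ toℕ i
  ; sym    = swap
  ; irrefl = λ { refl (inj₁ eq) → 1+n≢n eq ; refl (inj₂ eq) → 1+n≢n eq }
  }

record Decomposition (G T : Graph) : Set₁ where
  open Graph G using (_∼_)
  field
    Bag              : Vertex T → VertexSet G
    covers-vertices  : ∀ v → ∃[ t ] v ∈ Bag t
    covers-edges     : ∀ {u v} → u ∼ v → ∃[ t ] (u ∈ Bag t × v ∈ Bag t)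
    bags-connected   : ∀ v → Connected (induced T (λ t → v ∈ Bag t))

WidthAtMost : ∀ {G T} → ℕ → Decomposition G T → Set
WidthAtMost w D = ∀ t → AtMost (suc w) (Decomposition.Bag D t)

-- The minima below are not computed: an upper bound on a minimum is a witness
-- meeting that bound, and an inequality between two minima says that
-- every upper bound on the right-hand one is an upper bound on the left-hand one.

FeedbackVertexNumberAtMost : ℕ → Graph → Set₁
FeedbackVertexNumberAtMost k G =
  Σ[ A ∈ VertexSet G ] (AtMost k A × IsForest (G ─ A))

TreewidthAtMost : ℕ → Graph → Set₁
TreewidthAtMost w G =
  Σ[ T ∈ Graph ] (IsTree T × (Σ[ D ∈ Decomposition G T ] WidthAtMost w D))

PathwidthAtMost : ℕ → Graph → Set₁
PathwidthAtMost w G =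
  Σ[ m ∈ ℕ ] Σ[ D ∈ Decomposition G (path m) ] WidthAtMost w D

Treewidth≤Pathwidth : Graph → Set₁
Treewidth≤Pathwidth G = ∀ w → PathwidthAtMost w G → TreewidthAtMost w G

Colouring : ℕ → Graph → Set
Colouring r G = Vertex G → Fin r

colourClass : ∀ {r} (G : Graph) → Colouring r G → Fin r → Graph
colourClass G φ i = induced G (λ v → φ v ≡ i)

HasClustering : ∀ {r} (G : Graph) → Colouring r G → ℕ → Set
HasClustering G φ c =
  ∀ i (v : Vertex (colourClass G φ i)) → AtMost c (Component (colourClass G φ i) v)

{-# OPTIONS --safe #-}
module Submission where

-- Join 7 apices to many disjoint paths: each path follows a 4-set of apices that is
-- monochromatic for some 2-colouring ψ of the apices, its i-th vertex being joined to the
-- (i mod 4)-th apex of the set, and every ψ is served by 4c + 1 paths.  Given a 2-colouring of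
-- the whole graph with clustering c, consider the paths serving its restriction to the apices:
-- none avoids the colour i of its 4 apices, since it would be a monochromatic component with
-- more than c vertices, so some apex of colour i has more than c neighbours of colour i.
-- Two apices on a cycle are at distance at least 3 along it, because a path vertex has a unique
-- apex; hence a cycle of length at most 5 has exactly one apex, and the rest of it is a stretch
-- of 2, 3 or 4 vertices of a path whose ends have the same apex, which is impossible.  Sweeping
-- along the paths with all apices and two consecutive vertices in each bag gives width 8.

open import Defs
open import Data.Empty using (⊥; ⊥-elim; ⊥-elim-irr)
open import Data.Fin using (Fin; zero; suc; toℕ; inject₁; inject≤; _↑ˡ_; combine; quotient; funToFin; finToFun)
import Data.Fin.Properties as Fin
open import Data.Irrelevant using ([_])
open import Data.List using (List; []; _∷_; _++_; length; map; filter; lookup; tabulate; allFin)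
import Data.List.Properties as List
import Data.List.Membership.Propositional as List
open import Data.List.Membership.Propositional.Properties using (∈-lookup; ∈-allFin)
open import Data.List.Relation.Unary.All as All using (All; []; _∷_)
import Data.List.Relation.Unary.All.Properties as All
open import Data.List.Relation.Unary.AllPairs using ([]; _∷_)
import Data.List.Relation.Unary.AllPairs.Properties as AllPairs
open import Data.List.Relation.Unary.Any using (Any; here; there)
open import Data.List.Relation.Unary.Linked as Linked using (Linked; []; [-]; _∷_)
import Data.List.Relation.Unary.Linked.Properties as Linked
open import Data.List.Relation.Unary.Unique.Propositional using (Unique)
import Data.List.Relation.Unary.Unique.Propositional.Properties as Unique
open import Data.Nat using (ℕ; zero; suc; _+_; _*_; _^_; _≤_; _<_; z≤n; s≤s; _<?_; _≤?_; _≟_)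
open import Data.Nat.Properties hiding (_<?_; _≤?_; _≟_)
open import Data.Product using (Σ-syntax; ∃-syntax; _×_; _,_; proj₁; proj₂)
open import Data.Refinement using (_,_; value)
open import Data.Sum as Sum using (_⊎_; inj₁; inj₂; swap)
open import Data.Sum.Function.Propositional using (_⊎-↔_)
open import Data.Sum.Properties using (inj₂-injective)
open import Data.Unit using (⊤; tt)
open import Function using (_∘_; flip; Injective)
open import Function.Construct.Composition using (_↔-∘_)
open import Function.Construct.Identity using (↔-id)
open import Function.Construct.Symmetry using (↔-sym)
open import Level using (0ℓ)
open import Relation.Binary using (Rel; Transitive)
open import Relation.Binary.Construct.Closure.ReflexiveTransitive using (Star; ε; _◅_; _◅◅_; gmap; reverse)
open import Relation.Binary.PropositionalEquality hiding ([_])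
open import Relation.Nullary using (¬_; yes; no; contradiction)
open import Relation.Nullary.Decidable using (Dec; ¬?; from-yes; recompute; _×-dec_; _⊎-dec_)
open import Relation.Unary using (Pred; Decidable)

-- Counting with duplicate-free lists

lookup-injective : ∀ {A : Set} {xs : List A} → Unique xs → Injective _≡_ _≡_ (lookup xs)
lookup-injective (_ ∷ _) {zero} {zero} _ = refl
lookup-injective (x∉xs ∷ _) {zero} {suc j} eq = contradiction eq (All.lookup x∉xs (∈-lookup j))
lookup-injective (x∉xs ∷ _) {suc i} {zero} eq = contradiction (sym eq) (All.lookup x∉xs (∈-lookup i))
lookup-injective (_ ∷ xs!) {suc i} {suc j} eq = cong suc (lookup-injective xs! eq)

atMost : ∀ {A : Set} {P : Pred A 0ℓ} {n} (code : ∀ {x} → P x → Fin n) →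
         (∀ {x y} (px : P x) (py : P y) → code px ≡ code py → x ≡ y) → AtMost n P
atMost code code-injective xs xs! pxs =
  Fin.injective⇒≤ {f = λ i → code (All.lookup pxs (∈-lookup i))}
    (lookup-injective xs! ∘ code-injective _ _)

length-filter-∁ : ∀ {A : Set} {P : Pred A 0ℓ} (P? : Decidable P) xs →
                  length (filter P? xs) + length (filter (¬? ∘ P?) xs) ≡ length xs
length-filter-∁ P? [] = refl
length-filter-∁ P? (x ∷ xs) with P? x
... | yes _ = cong suc (length-filter-∁ P? xs)
... | no  _ = trans (+-suc _ _) (cong suc (length-filter-∁ P? xs))

module _ {n r} (f : Fin n → Fin r) (k : ℕ) where

  -- Either the first value is taken more than `k` times, or dropping its at most `k` occurrences
  -- leaves too many entries for the other values.
  pigeonhole-list : ∀ js xs → Unique xs → All (λ x → f x List.∈ js) xs → length js * k < length xs →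
                    ∃[ j ] ∃[ ys ] (Unique ys × All (λ y → f y ≡ j) ys × k < length ys)
  pigeonhole-list [] (x ∷ xs) _ (() ∷ _) _
  pigeonhole-list (j ∷ js) xs xs! fxs∈ many with k <? length (filter (λ x → f x Fin.≟ j) xs)
  ... | yes k< = j , filter (λ x → f x Fin.≟ j) xs , Unique.filter⁺ _ xs! , All.all-filter _ xs , k<
  ... | no  k≮ = pigeonhole-list js others (Unique.filter⁺ _ xs!)
                   (All.zipWith (λ { (here eq , neq) → contradiction eq neq ; (there fx∈ , _) → fx∈ })
                     (All.filter⁺ _ fxs∈ , All.all-filter _ xs))
                   (+-cancelˡ-< k _ _ (<-≤-trans many
                     (≤-trans (≤-reflexive (sym (length-filter-∁ _ xs))) (+-monoˡ-≤ _ (≮⇒≥ k≮)))))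
    where others = filter (¬? ∘ λ x → f x Fin.≟ j) xs

  pigeonhole : r * k < n →
               ∃[ j ] Σ[ g ∈ (Fin (suc k) → Fin n) ] (Injective _≡_ _≡_ g × (∀ i → f (g i) ≡ j))
  pigeonhole many
    with j , ys , ys! , fys≡j , k< ←
           pigeonhole-list (allFin r) (allFin n) (Unique.allFin⁺ n) (All.universal (∈-allFin ∘ f) _)
             (subst₂ (λ p q → p * k < q) (sym (List.length-tabulate {n = r} _)) (sym (List.length-tabulate {n = n} _)) many)
    = j , (λ i → lookup ys (inject≤ i k<))
        , (λ eq → Fin.inject≤-injective k< k< _ _ (lookup-injective ys! eq))
        , (λ i → All.lookup fys≡j (∈-lookup (inject≤ i k<)))

-- Rotating and transporting cycles

IsCycle : (G : Graph) → Vertex G → List (Vertex G) → Set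
IsCycle G x xs = Unique (x ∷ xs) × Linked (Graph._∼_ G) (x ∷ xs ++ x ∷ [])

module _ {A : Set} where

  snoc-unique : ∀ {x : A} {xs} → Unique (x ∷ xs) → Unique (xs ++ x ∷ [])
  snoc-unique (x∉xs ∷ xs!) = AllPairs.++⁺ xs! ([] ∷ []) (All.map (λ x≢y → (x≢y ∘ sym) ∷ []) x∉xs)

  snoc-linked : ∀ {R : Rel A 0ℓ} xs {x y} → Linked R (xs ++ x ∷ []) → R x y →
                Linked R ((xs ++ x ∷ []) ++ y ∷ [])
  snoc-linked []           [-]        r = r ∷ [-]
  snoc-linked (_ ∷ [])     (r₁ ∷ [-]) r = r₁ ∷ r ∷ [-]
  snoc-linked (_ ∷ y ∷ xs) (r₁ ∷ rs)  r = r₁ ∷ snoc-linked (y ∷ xs) rs r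

module _ {G : Graph} where

  rotate : ∀ {x y ys} → IsCycle G x (y ∷ ys) → IsCycle G y (ys ++ x ∷ [])
  rotate {y = y} {ys} (xs! , r ∷ rs) = snoc-unique xs! , snoc-linked (y ∷ ys) rs r

  -- `zs` collects the vertices already rotated past; the search stays within `x ∷ xs`, so it ends
  -- before wrapping around.
  rotate-to : ∀ {P : Pred (Vertex G) 0ℓ} x xs zs → Any P (x ∷ xs) → IsCycle G x (xs ++ zs) →
              ∃[ y ] ∃[ ys ] (P y × IsCycle G y ys × length ys ≡ length (xs ++ zs))
  rotate-to x xs zs (here px) c = x , xs ++ zs , px , c , refl
  rotate-to x (y ∷ xs) zs (there any) c
    with z , ys , pz , c′ , eq ← rotate-to y xs (zs ++ x ∷ []) any
           (subst (IsCycle G y) (List.++-assoc xs zs _) (rotate c))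
    = z , ys , pz , c′ , trans eq (trans (cong length (sym (List.++-assoc xs zs (x ∷ []))))
        (trans (List.length-++ (xs ++ zs)) (+-comm _ 1)))

map-cycle : ∀ {G H} (f : Vertex G → Vertex H) → Injective _≡_ _≡_ f →
            (∀ {u v} → Graph._∼_ G u v → Graph._∼_ H (f u) (f v)) → ∀ {k} → Cycle G k → Cycle H k
map-cycle {G} {H} f f-injective f-hom c = record
  { start    = f start
  ; rest     = map f rest
  ; length≡k = trans (cong suc (List.length-map f rest)) length≡k
  ; 3≤k      = 3≤k
  ; distinct = Unique.map⁺ f-injective distinct
  ; closed   = subst (Linked (Graph._∼_ H) ∘ (f start ∷_)) (List.map-++ f rest _) (Linked.map⁺ (Linked.map f-hom closed))
  }
  where open Cycle c

-- Walks that cannot turn back, and forests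

module Oriented {V : Set} {_∼_ _⋖_ : Rel V 0ℓ}
                (orient : ∀ {u v} → u ∼ v → u ⋖ v ⊎ v ⋖ u)
                (predecessor-unique : ∀ {u v w} → u ⋖ w → v ⋖ w → u ≡ v) where

  -- Traversed downwards, the edge from `v` to `w` would make `w` a second predecessor of `v`, hence
  -- equal to `u`.
  continue : ∀ {u v w} → u ⋖ v → v ∼ w → u ≢ w → v ⋖ w
  continue u⋖v v∼w u≢w with orient v∼w
  ... | inj₁ v⋖w = v⋖w
  ... | inj₂ w⋖v = contradiction (predecessor-unique u⋖v w⋖v) u≢w

  ascend : ∀ {u v ws} → Unique (u ∷ v ∷ ws) → Linked _∼_ (u ∷ v ∷ ws) → u ⋖ v → Linked _⋖_ (u ∷ v ∷ ws)
  ascend _ (_ ∷ [-]) u⋖v = u⋖v ∷ [-]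
  ascend ((_ ∷ u≢w ∷ _) ∷ ws!) (_ ∷ v∼w ∷ ws) u⋖v = u⋖v ∷ ascend ws! (v∼w ∷ ws) (continue u⋖v v∼w u≢w)

  climb : ∀ {_⊏_ : Rel V 0ℓ} → Transitive _⊏_ → (∀ {u v} → u ⋖ v → u ⊏ v) →
          ∀ {u v w z} ws → Unique (u ∷ v ∷ w ∷ ws) → Linked _∼_ (u ∷ v ∷ w ∷ ws ++ z ∷ []) → u ⋖ v → u ⊏ z
  climb {_⊏_} ⊏-trans ⋖⇒⊏ = go
    where
    go : ∀ {u v w z} ws → Unique (u ∷ v ∷ w ∷ ws) → Linked _∼_ (u ∷ v ∷ w ∷ ws ++ z ∷ []) → u ⋖ v → u ⊏ z
    go [] ((_ ∷ u≢w ∷ []) ∷ _) (_ ∷ v∼w ∷ w∼z ∷ [-]) u⋖v with orient w∼z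
    ... | inj₁ w⋖z = ⊏-trans (⋖⇒⊏ u⋖v) (⊏-trans (⋖⇒⊏ (continue u⋖v v∼w u≢w)) (⋖⇒⊏ w⋖z))
    -- `z` need not be new, so the last edge may turn back; then `z` is `v`, and `u ⊏ v` is already
    -- known.
    ... | inj₂ z⋖w rewrite predecessor-unique z⋖w (continue u⋖v v∼w u≢w) = ⋖⇒⊏ u⋖v
    go (x ∷ ws) ((_ ∷ u≢w ∷ _) ∷ vs!) (_ ∷ vs@(v∼w ∷ _)) u⋖v =
      ⊏-trans (⋖⇒⊏ u⋖v) (go ws vs! vs (continue u⋖v v∼w u≢w))

-- A cycle keeps the direction of its first edge, so the rank would strictly rise or strictly fall
-- all the way round.
ranked⇒forest : ∀ (G : Graph) (_⋖_ : Rel (Vertex G) 0ℓ) (rank : Vertex G → ℕ) →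
                (∀ {u v} → Graph._∼_ G u v → u ⋖ v ⊎ v ⋖ u) →
                (∀ {u v w} → u ⋖ w → v ⋖ w → u ≡ v) →
                (∀ {u v w} → u ⋖ v → u ⋖ w → v ≡ w) →
                (∀ {u v} → u ⋖ v → rank u < rank v) → IsForest G
ranked⇒forest G _⋖_ rank orient pred-unique succ-unique rank-mono k c with c
... | record { rest = [] ; length≡k = refl ; 3≤k = s≤s () }
... | record { rest = _ ∷ [] ; length≡k = refl ; 3≤k = s≤s (s≤s ()) }
... | record { rest = v ∷ w ∷ ws ; distinct = us! ; closed = us@(u∼v ∷ _) } with orient u∼v
...   | inj₁ u⋖v = <-irrefl refl (Oriented.climb orient pred-unique <-trans rank-mono ws us! us u⋖v)
...   | inj₂ v⋖u = <-irrefl refl (Oriented.climb {_⋖_ = flip _⋖_} (swap ∘ orient) succ-unique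
                     {_⊏_ = λ x y → rank y < rank x} (flip <-trans) rank-mono ws us! us v⋖u)

-- Paths as trees

module _ {m : ℕ} where

  open Graph (path m) using (_∼_)

  predecessor-injective : ∀ {i j k : Fin m} → suc (toℕ i) ≡ toℕ k → suc (toℕ j) ≡ toℕ k → i ≡ j
  predecessor-injective i⋖k j⋖k = Fin.toℕ-injective (suc-injective (trans i⋖k (sym j⋖k)))

  successor-injective : ∀ {i j k : Fin m} → suc (toℕ i) ≡ toℕ j → suc (toℕ i) ≡ toℕ k → j ≡ k
  successor-injective i⋖j i⋖k = Fin.toℕ-injective (trans (sym i⋖j) i⋖k)

path-from-zero : ∀ m (i : Fin (suc m)) → Star (Graph._∼_ (path m)) zero i
path-from-zero m       zero    = ε
path-from-zero (suc m) (suc i) =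
  inj₁ refl ◅ gmap suc (Sum.map (cong suc) (cong suc)) (path-from-zero m i)

path-connected : ∀ m → Connected (path m)
path-connected m i j = reverse swap (path-from-zero m j) ◅◅ path-from-zero m i

path-isTree : ∀ m → IsTree (path m)
path-isTree m = record
  { finite    = record
    { order       = suc m
    ; enumeration = ↔-id _
    ; _∼?_        = λ i j → (suc (toℕ i) ≟ toℕ j) ⊎-dec (suc (toℕ j) ≟ toℕ i)
    }
  ; nonempty  = zero
  ; connected = path-connected m
  ; forest    = ranked⇒forest (path m) (λ i j → suc (toℕ i) ≡ toℕ j) toℕ (λ i∼j → i∼j)
                  predecessor-injective successor-injective ≤-reflexive
  }

treewidth≤pathwidth : ∀ G → Treewidth≤Pathwidth G
treewidth≤pathwidth G w (m , D , width) = path m , path-isTree m , D , width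

-- Residues modulo 4

next : Fin 4 → Fin 4
next zero                   = suc zero
next (suc zero)             = suc (suc zero)
next (suc (suc zero))       = suc (suc (suc zero))
next (suc (suc (suc zero))) = zero

residue : ℕ → Fin 4
residue zero    = zero
residue (suc i) = next (residue i)

-- Checked on all four residues. That one, two or three steps never return excludes cycles of length
-- 3, 4 and 5; the fourth step returns and yields the hexagon.
next≢ : ∀ x → next x ≢ x
next≢ = from-yes (Fin.all? λ x → ¬? (next x Fin.≟ x))

next²≢ : ∀ x → next (next x) ≢ x
next²≢ = from-yes (Fin.all? λ x → ¬? (next (next x) Fin.≟ x))

next³≢ : ∀ x → next (next (next x)) ≢ x
next³≢ = from-yes (Fin.all? λ x → ¬? (next (next (next x)) Fin.≟ x))

≢⇒≡ : ∀ {i j k : Fin 2} → j ≢ i → k ≢ i → j ≡ k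
≢⇒≡ {_}        {zero}     {zero}     _   _   = refl
≢⇒≡ {_}        {suc zero} {suc zero} _   _   = refl
≢⇒≡ {zero}     {zero}     {suc zero} j≢i _   = contradiction refl j≢i
≢⇒≡ {zero}     {suc zero} {zero}     _   k≢i = contradiction refl k≢i
≢⇒≡ {suc zero} {zero}     {suc zero} _   k≢i = contradiction refl k≢i
≢⇒≡ {suc zero} {suc zero} {zero}     j≢i _   = contradiction refl j≢i

-- The graph of apices and paths

-- Position (b , i) is the i-th vertex of the b-th path.
module Blocks (n B c : ℕ) (anchor : Fin B → Fin 4 → Fin n)
              (anchor-injective : ∀ b → Injective _≡_ _≡_ (anchor b)) where

  -- A path has `suc l`, that is 5 + c, vertices: more than `c`, and at least the five that a
  -- hexagon takes from it.
  l : ℕ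
  l = 4 + c

  Position : Set
  Position = Fin B × Fin (suc l)

  _⋖_ : Rel Position 0ℓ
  (b , i) ⋖ (b′ , j) = b ≡ b′ × suc (toℕ i) ≡ toℕ j

  ⋖-irrefl : ∀ {p} → ¬ p ⋖ p
  ⋖-irrefl (_ , eq) = 1+n≢n eq

  paths : Graph
  paths = record
    { Vertex = Position
    ; _∼_    = λ p q → p ⋖ q ⊎ q ⋖ p
    ; sym    = swap
    ; irrefl = λ { refl → Sum.[ ⋖-irrefl , ⋖-irrefl ] }
    }

  -- All paths are laid end to end. This numbering serves both as the height that makes `paths` a
  -- forest and as the time in the path decomposition.
  rank : Position → ℕ
  rank (b , i) = toℕ (combine b i)

  rank-injective : Injective _≡_ _≡_ rank
  rank-injective {b , i} {b′ , j} eq with refl , refl ← Fin.combine-injective b i b′ j (Fin.toℕ-injective eq) = refl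

  rank-⋖ : ∀ {p q} → p ⋖ q → suc (rank p) ≡ rank q
  rank-⋖ {b , i} {_ , j} (refl , eq) = begin
    suc (toℕ (combine b i))          ≡⟨ cong suc (Fin.toℕ-combine b i) ⟩
    suc (suc l * toℕ b + toℕ i)      ≡⟨ +-suc _ (toℕ i) ⟨
    suc l * toℕ b + suc (toℕ i)      ≡⟨ cong (suc l * toℕ b +_) eq ⟩
    suc l * toℕ b + toℕ j            ≡⟨ Fin.toℕ-combine b j ⟨
    toℕ (combine b j)                ∎
    where open ≡-Reasoning

  ⋖-predecessor-unique : ∀ {p q r} → p ⋖ r → q ⋖ r → p ≡ q
  ⋖-predecessor-unique (refl , eq) (refl , eq′) = cong (_ ,_) (predecessor-injective eq eq′)

  ⋖-successor-unique : ∀ {p q r} → p ⋖ q → p ⋖ r → q ≡ r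
  ⋖-successor-unique (refl , eq) (refl , eq′) = cong (_ ,_) (successor-injective eq eq′)

  paths-forest : IsForest paths
  paths-forest = ranked⇒forest paths _⋖_ rank (λ p∼q → p∼q)
    ⋖-predecessor-unique ⋖-successor-unique (≤-reflexive ∘ rank-⋖)

  apex : Position → Fin n
  apex (b , i) = anchor b (residue (toℕ i))

  V : Set
  V = Fin n ⊎ Position

  _∼_ : Rel V 0ℓ
  inj₁ _ ∼ inj₁ _ = ⊥
  inj₁ a ∼ inj₂ p = apex p ≡ a
  inj₂ p ∼ inj₁ a = apex p ≡ a
  inj₂ p ∼ inj₂ q = p ⋖ q ⊎ q ⋖ p

  ∼-sym : ∀ {u v} → u ∼ v → v ∼ u
  ∼-sym {inj₁ _} {inj₂ _} eq = eq
  ∼-sym {inj₂ _} {inj₁ _} eq = eq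
  ∼-sym {inj₂ _} {inj₂ _} p∼q = swap p∼q

  G : Graph
  G = record
    { Vertex = V
    ; _∼_    = _∼_
    ; sym    = λ {u} {v} → ∼-sym {u} {v}
    ; irrefl = λ { {inj₂ _} refl → Sum.[ ⋖-irrefl , ⋖-irrefl ] }
    }

  _⋖?_ : ∀ p q → Dec (p ⋖ q)
  (b , i) ⋖? (b′ , j) = (b Fin.≟ b′) ×-dec (suc (toℕ i) ≟ toℕ j)

  _∼?_ : ∀ u v → Dec (u ∼ v)
  inj₁ _ ∼? inj₁ _ = no λ ()
  inj₁ a ∼? inj₂ p = apex p Fin.≟ a
  inj₂ p ∼? inj₁ a = apex p Fin.≟ a
  inj₂ p ∼? inj₂ q = (p ⋖? q) ⊎-dec (q ⋖? p)

  finite : IsFinite G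
  finite = record
    { order       = n + B * suc l
    ; enumeration = ↔-sym Fin.+↔⊎ ↔-∘ (↔-id _ ⊎-↔ ↔-sym Fin.*↔×)
    ; _∼?_        = _∼?_
    }

  -- The apices as a feedback vertex set

  IsApex : Pred V 0ℓ
  IsApex v = ∃[ a ] v ≡ inj₁ a

  feedback : FeedbackVertexNumberAtMost n G
  feedback = IsApex
           , atMost proj₁ (λ { (_ , refl) (_ , refl) refl → refl })
           , λ k → paths-forest k ∘ map-cycle position position-injective position-hom
    where
    position : Vertex (G ─ IsApex) → Position
    position (inj₁ a , [ ¬apex ]) = ⊥-elim-irr (¬apex (a , refl))
    position (inj₂ p , _)         = p

    position-injective : Injective _≡_ _≡_ position
    position-injective {inj₁ a , [ ¬apex ]} {_}                  = ⊥-elim-irr (¬apex (a , refl))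
    position-injective {inj₂ _ , _}         {inj₁ a , [ ¬apex ]} = ⊥-elim-irr (¬apex (a , refl))
    position-injective {inj₂ _ , _}         {inj₂ _ , _} refl    = refl

    position-hom : ∀ {u v} → value u ∼ value v → Graph._∼_ paths (position u) (position v)
    position-hom {inj₁ a , [ ¬apex ]} {_}                  = ⊥-elim-irr (¬apex (a , refl))
    position-hom {inj₂ _ , _}         {inj₁ a , [ ¬apex ]} = ⊥-elim-irr (¬apex (a , refl))
    position-hom {inj₂ _ , _}         {inj₂ _ , _} p∼q     = p∼q

  -- Path decomposition

  Bag : ℕ → V → Set
  Bag t (inj₁ _) = ⊤
  Bag t (inj₂ p) = rank p ≡ t ⊎ rank p ≡ suc t

  order : ℕ
  order = B * suc l

  -- `path order` has one node more than there are positions, hence `inject₁`; the bag at the last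
  -- node holds only apices.
  node : Position → Fin (suc order)
  node (b , i) = inject₁ (combine b i)

  toℕ-node : ∀ p → rank p ≡ toℕ (node p)
  toℕ-node (b , i) = sym (Fin.toℕ-inject₁ (combine b i))

  decomposition : Decomposition G (path order)
  decomposition = record
    { Bag             = Bag ∘ toℕ
    ; covers-vertices = λ { (inj₁ _) → zero , tt ; (inj₂ p) → node p , inj₁ (toℕ-node p) }
    ; covers-edges    = λ {u} {v} → covers-edges {u} {v}
    ; bags-connected  = bags-connected
    }
    where
    covers-⋖ : ∀ {p q} → p ⋖ q → Bag (toℕ (node p)) (inj₂ q)
    covers-⋖ {p} p⋖q = inj₂ (trans (sym (rank-⋖ p⋖q)) (cong suc (toℕ-node p)))

    covers-edges : ∀ {u v} → u ∼ v → ∃[ t ] (Bag (toℕ t) u × Bag (toℕ t) v)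
    covers-edges {inj₁ _} {inj₂ p} _ = node p , tt , inj₁ (toℕ-node p)
    covers-edges {inj₂ p} {inj₁ _} _ = node p , inj₁ (toℕ-node p) , tt
    covers-edges {inj₂ p} {inj₂ q} (inj₁ p⋖q) = node p , inj₁ (toℕ-node p) , covers-⋖ p⋖q
    covers-edges {inj₂ p} {inj₂ q} (inj₂ q⋖p) = node q , covers-⋖ q⋖p , inj₁ (toℕ-node q)

    bags-connected : ∀ v → Connected (induced (path order) (λ t → Bag (toℕ t) v))
    bags-connected (inj₁ _) (s , _) (t , _) =
      gmap (λ t → t , [ tt ]) (λ e → e) (path-connected order s t)
    bags-connected (inj₂ p) (s , [ s∈ ]) (t , [ t∈ ]) with member s s∈ | member t t∈
      where
      -- Membership is irrelevant in the induced subgraph; deciding it again recovers which disjunct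
      -- holds.
      member : ∀ s → .(Bag (toℕ s) (inj₂ p)) → Bag (toℕ s) (inj₂ p)
      member s = recompute ((rank p ≟ toℕ s) ⊎-dec (rank p ≟ suc (toℕ s)))
    -- The position lies only in the bag at its rank and in the one just before, and these nodes are
    -- adjacent.
    ... | inj₁ eq | inj₂ eq′ = inj₁ (trans (sym eq′) eq) ◅ ε
    ... | inj₂ eq | inj₁ eq′ = inj₂ (trans (sym eq) eq′) ◅ ε
    ... | inj₁ eq | inj₁ eq′ with refl ← Fin.toℕ-injective (trans (sym eq) eq′) = ε
    ... | inj₂ eq | inj₂ eq′ with refl ← Fin.toℕ-injective (suc-injective (trans (sym eq) eq′)) = ε

  pathwidth : PathwidthAtMost (suc n) G
  pathwidth = order , decomposition , λ t → atMost code (code-injective _ _)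
    where
    -- Codes 0 and 1 go to the positions of rank `t` and `suc t`, at most one each, the other `n` to
    -- the apices; bag size `2 + n` means width `suc n`.
    code : ∀ {t v} → Bag t v → Fin (2 + n)
    code {v = inj₁ a} _        = suc (suc a)
    code {v = inj₂ p} (inj₁ _) = zero
    code {v = inj₂ p} (inj₂ _) = suc zero

    code-injective : ∀ {t} u v (u∈ : Bag t u) (v∈ : Bag t v) → code u∈ ≡ code v∈ → u ≡ v
    code-injective (inj₁ _) (inj₁ _) _ _ refl = refl
    code-injective (inj₁ _) (inj₂ _) _ (inj₁ _) ()
    code-injective (inj₁ _) (inj₂ _) _ (inj₂ _) ()
    code-injective (inj₂ _) (inj₁ _) (inj₁ _) _ ()
    code-injective (inj₂ _) (inj₁ _) (inj₂ _) _ ()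
    code-injective (inj₂ p) (inj₂ q) (inj₁ eq) (inj₁ eq′) _ = cong inj₂ (rank-injective (trans eq (sym eq′)))
    code-injective (inj₂ p) (inj₂ q) (inj₂ eq) (inj₂ eq′) _ = cong inj₂ (rank-injective (trans eq (sym eq′)))

  -- Girth

  apex-⋖ : ∀ {p q} → p ⋖ q → apex p ≢ apex q
  apex-⋖ {b , i} (refl , eq) eqₐ = next≢ _ (trans (cong residue eq) (sym (anchor-injective b eqₐ)))

  -- As the anchors of one path are distinct, equal apices would mean equal residues, although these
  -- lie two steps apart.
  apex-⋖² : ∀ {p q r} → p ⋖ q → q ⋖ r → apex p ≢ apex r
  apex-⋖² {b , i} (refl , eq₁) (refl , eq₂) eqₐ =
    next²≢ _ (trans (cong residue (trans (cong suc eq₁) eq₂)) (sym (anchor-injective b eqₐ)))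

  apex-⋖³ : ∀ {p q r s} → p ⋖ q → q ⋖ r → r ⋖ s → apex p ≢ apex s
  apex-⋖³ {b , i} (refl , eq₁) (refl , eq₂) (refl , eq₃) eqₐ =
    next³≢ _ (trans (cong residue (trans (cong suc (trans (cong suc eq₁) eq₂)) eq₃))
                    (sym (anchor-injective b eqₐ)))

  monotone : ∀ {p q ps} → Unique (p ∷ q ∷ ps) → Linked (Graph._∼_ paths) (p ∷ q ∷ ps) →
             Linked _⋖_ (p ∷ q ∷ ps) ⊎ Linked (flip _⋖_) (p ∷ q ∷ ps)
  monotone ps! ps@(inj₁ p⋖q ∷ _) =
    inj₁ (Oriented.ascend (λ p∼q → p∼q) ⋖-predecessor-unique ps! ps p⋖q)
  monotone ps! ps@(inj₂ q⋖p ∷ _) =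
    inj₂ (Oriented.ascend {_⋖_ = flip _⋖_} swap ⋖-successor-unique ps! ps q⋖p)

  -- A second apex would be within two steps of `a` along the cycle, but apices are pairwise
  -- non-adjacent and a path vertex has a single apex. So the rest is a stretch of one path with
  -- both ends joined to `a`.
  no-short-cycle-at-apex : ∀ {a} xs → 2 ≤ length xs → length xs ≤ 4 → ¬ IsCycle G (inj₁ a) xs
  no-short-cycle-at-apex (_ ∷ []) (s≤s ()) _ _
  no-short-cycle-at-apex (inj₁ _ ∷ _ ∷ _) _ _ (_ , () ∷ _)
  no-short-cycle-at-apex (inj₂ p ∷ inj₁ b ∷ _) _ _ ((_ ∷ a≢b ∷ _) ∷ _ , a∼p ∷ p∼b ∷ _) =
    a≢b (cong inj₁ (trans (sym a∼p) p∼b))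
  no-short-cycle-at-apex (inj₂ p ∷ inj₂ q ∷ []) _ _ (_ ∷ ps! , a∼p ∷ p∼q ∷ q∼a ∷ [-])
    with monotone (Unique.map⁻ ps!) (p∼q ∷ [-])
  ... | inj₁ (e ∷ [-]) = apex-⋖ e (trans a∼p (sym q∼a))
  ... | inj₂ (e ∷ [-]) = apex-⋖ e (trans q∼a (sym a∼p))
  no-short-cycle-at-apex (inj₂ p ∷ inj₂ q ∷ inj₁ _ ∷ []) _ _ (_ , _ ∷ _ ∷ _ ∷ () ∷ _)
  no-short-cycle-at-apex (inj₂ p ∷ inj₂ q ∷ inj₂ r ∷ []) _ _ (_ ∷ ps! , a∼p ∷ p∼q ∷ q∼r ∷ r∼a ∷ [-])
    with monotone (Unique.map⁻ ps!) (p∼q ∷ q∼r ∷ [-])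
  ... | inj₁ (e₁ ∷ e₂ ∷ [-]) = apex-⋖² e₁ e₂ (trans a∼p (sym r∼a))
  ... | inj₂ (e₁ ∷ e₂ ∷ [-]) = apex-⋖² e₂ e₁ (trans r∼a (sym a∼p))
  no-short-cycle-at-apex (inj₂ p ∷ inj₂ q ∷ _ ∷ inj₁ _ ∷ []) _ _ (_ , _ ∷ _ ∷ _ ∷ _ ∷ () ∷ _)
  no-short-cycle-at-apex (inj₂ p ∷ inj₂ q ∷ inj₁ b ∷ inj₂ s ∷ []) _ _
    ((_ ∷ _ ∷ a≢b ∷ _) ∷ _ , _ ∷ _ ∷ _ ∷ b∼s ∷ s∼a ∷ [-]) = a≢b (cong inj₁ (trans (sym s∼a) b∼s))
  no-short-cycle-at-apex (inj₂ p ∷ inj₂ q ∷ inj₂ r ∷ inj₂ s ∷ []) _ _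
    (_ ∷ ps! , a∼p ∷ p∼q ∷ q∼r ∷ r∼s ∷ s∼a ∷ [-])
    with monotone (Unique.map⁻ ps!) (p∼q ∷ q∼r ∷ r∼s ∷ [-])
  ... | inj₁ (e₁ ∷ e₂ ∷ e₃ ∷ [-]) = apex-⋖³ e₁ e₂ e₃ (trans a∼p (sym s∼a))
  ... | inj₂ (e₁ ∷ e₂ ∷ e₃ ∷ [-]) = apex-⋖³ e₃ e₂ e₁ (trans s∼a (sym a∼p))
  no-short-cycle-at-apex (_ ∷ _ ∷ _ ∷ _ ∷ _ ∷ _) _ (s≤s (s≤s (s≤s (s≤s ())))) _

  find-apex : ∀ vs → Any IsApex vs ⊎ (∃[ ps ] vs ≡ map inj₂ ps)
  find-apex [] = inj₂ ([] , refl)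
  find-apex (inj₁ a ∷ vs) = inj₁ (here (a , refl))
  find-apex (inj₂ p ∷ vs) = Sum.map there (λ { (ps , refl) → p ∷ ps , refl }) (find-apex vs)

  -- A cycle with no apex lies in the forest `paths`; any other can be started at an apex by
  -- rotation.
  6≤cycle : ∀ k → Cycle G k → 6 ≤ k
  6≤cycle k record { start = x ; rest = xs ; length≡k = refl ; 3≤k = s≤s 2≤ ; distinct = xs! ; closed = edges }
    with find-apex (x ∷ xs)
  ... | inj₂ (p ∷ ps , refl) = ⊥-elim (paths-forest k record
    { start    = p
    ; rest     = ps
    ; length≡k = cong suc (sym (List.length-map inj₂ ps))
    ; 3≤k      = s≤s 2≤
    ; distinct = Unique.map⁻ xs!
    ; closed   = Linked.map⁻ (subst (Linked _∼_ ∘ (inj₂ p ∷_)) (sym (List.map-++ inj₂ ps (p ∷ []))) edges)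
    })
  ... | inj₁ any with 6 ≤? k
  ...   | yes 6≤k = 6≤k
  ...   | no  6≰k with _ , ys , (a , refl) , cycle , eq ← rotate-to {G} {IsApex} x xs [] any
                         (subst (IsCycle G x) (sym (List.++-identityʳ xs)) (xs! , edges))
    = ⊥-elim (no-short-cycle-at-apex ys
        (≤-trans 2≤ (≤-reflexive (sym len)))
        (≤-trans (≤-reflexive len) (≤-pred (≤-pred (≰⇒> 6≰k)))) cycle)
    where
    len : length ys ≡ length xs
    len = trans eq (cong length (List.++-identityʳ xs))

  -- Residues repeat after four steps, so the first and the fifth vertex of a path share the apex
  -- `anchor b zero`.
  hexagon : Fin B → Cycle G 6
  hexagon b = record
    { start    = inj₁ (anchor b zero)
    ; rest     = tabulate corner
    ; length≡k = refl
    ; 3≤k      = s≤s (s≤s (s≤s z≤n))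
    ; distinct = All.tabulate⁺ {f = corner} (λ _ ()) ∷ Unique.tabulate⁺ {f = corner} corner-injective
    ; closed   = refl ∷ up ∷ up ∷ up ∷ up ∷ refl ∷ [-]
    }
    where
    corner : Fin 5 → V
    corner i = inj₂ (b , i ↑ˡ c)

    corner-injective : Injective _≡_ _≡_ corner
    corner-injective eq = Fin.↑ˡ-injective c _ _ (cong proj₂ (inj₂-injective eq))

    up : ∀ {i : ℕ} → (b ≡ b × suc i ≡ suc i) ⊎ (b ≡ b × suc (suc i) ≡ i)
    up = inj₁ (refl , refl)

  -- Large monochromatic components

  module _ (φ : Colouring 2 G) (clustering : HasClustering G φ c) where

    abstract
      -- With only two colours, a path avoiding `i` is monochromatic, and its 5 + c vertices lie in
      -- one component.
      block-hits : ∀ i b → ∃[ o ] φ (inj₂ (b , o)) ≡ i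
      block-hits i b with Fin.any? (λ o → φ (inj₂ (b , o)) Fin.≟ i)
      ... | yes hit = hit
      ... | no miss = contradiction
        (≤-trans (≤-reflexive (sym (List.length-tabulate block)))
          (clustering _ (block zero) (tabulate block)
            (Unique.tabulate⁺ {f = block} (cong proj₂ ∘ inj₂-injective ∘ cong value))
            (All.tabulate⁺ {f = block} λ o → gmap block (Sum.map (refl ,_) (refl ,_)) (path-connected l o zero))))
        (<⇒≱ (m≤n+m (suc c) 4))
        where
        block : Fin (suc l) → Vertex (colourClass G φ (φ (inj₂ (b , zero))))
        block o = inj₂ (b , o) , [ ≢⇒≡ (miss ∘ (o ,_)) (miss ∘ (zero ,_)) ]

    -- Each block supplies a vertex of colour `i`. Among these 4c + 1 vertices, c + 1 share a
    -- residue `j` and so are neighbours of the apex `t j`, also of colour `i`; lying in different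
    -- blocks, they are distinct.
    no-repeated-monochromatic-anchor :
      ∀ i (t : Fin 4 → Fin n) (block : Fin (suc (4 * c)) → Fin B) → Injective _≡_ _≡_ block →
      (∀ k j → anchor (block k) j ≡ t j) → ¬ (∀ j → φ (inj₁ (t j)) ≡ i)
    no-repeated-monochromatic-anchor i t block block-injective anchored mono
      with j , g , g-injective , residue≡j ← pigeonhole (λ k → residue (toℕ (proj₁ (block-hits i (block k))))) c ≤-refl
      = <-irrefl refl (≤-trans (≤-reflexive (sym (List.length-tabulate neighbour)))
          (clustering i (inj₁ (t j) , [ mono j ]) (tabulate neighbour)
            (Unique.tabulate⁺ {f = neighbour} λ eq → g-injective (block-injective (cong proj₁ (inj₂-injective (cong value eq)))))
            (All.tabulate⁺ {f = neighbour} λ x → trans (cong (anchor _) (residue≡j x)) (anchored (g x) j) ◅ ε)))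
      where
      neighbour : Fin (suc c) → Vertex (colourClass G φ i)
      neighbour x = inj₂ (block (g x) , proj₁ (block-hits i (block (g x)))) , [ proj₂ (block-hits i (block (g x))) ]

-- Anchors for every colouring of the apices

monochromatic : (ψ : Fin 7 → Fin 2) →
                ∃[ i ] Σ[ t ∈ (Fin 4 → Fin 7) ] (Injective _≡_ _≡_ t × (∀ j → ψ (t j) ≡ i))
-- Seven apices, two colours: `2 * 3 < 7`, so some colour occurs at least four times.
monochromatic ψ = pigeonhole ψ 3 ≤-refl

module _ (c : ℕ) where

  copies : ℕ
  copies = suc (4 * c)

  chosen : Fin (2 ^ 7) → Fin 4 → Fin 7
  chosen s = proj₁ (proj₂ (monochromatic (finToFun s)))

  -- A block number encodes a colouring of the apices, itself numbered by `Fin (2 ^ 7)`, and a copy;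
  -- `quotient` forgets the copy, so all copies share their anchors.
  anchor : Fin (2 ^ 7 * copies) → Fin 4 → Fin 7
  anchor b = chosen (quotient {2 ^ 7} copies b)

  anchor-injective : ∀ b → Injective _≡_ _≡_ (anchor b)
  anchor-injective b = proj₁ (proj₂ (proj₂ (monochromatic (finToFun (quotient {2 ^ 7} copies b)))))

  open Blocks 7 (2 ^ 7 * copies) c anchor anchor-injective

  unclusterable : ¬ (Σ[ φ ∈ Colouring 2 G ] HasClustering G φ c)
  unclusterable (φ , clustering) =
    no-repeated-monochromatic-anchor φ clustering (proj₁ (monochromatic (finToFun s))) (chosen s)
      (combine {2 ^ 7} s) (Fin.combine-injectiveʳ {2 ^ 7} {copies} s _ s _)
      (λ k j → cong (λ b → chosen (proj₁ b) j) (Fin.remQuot-combine {2 ^ 7} s k))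
      -- `chosen s` was selected for the colouring decoded from `s`, which agrees pointwise with `φ`
      -- on the apices.
      (λ j → trans (sym (Fin.finToFun-funToFin (φ ∘ inj₁) _))
                   (proj₂ (proj₂ (proj₂ (monochromatic (finToFun s)))) j))
    where
    s : Fin (2 ^ 7)
    s = funToFin (φ ∘ inj₁)

  girth-six : HasGirth G 6
  girth-six = hexagon (combine {2 ^ 7} zero zero) , 6≤cycle

proposition16 : ∀ (c : ℕ) → 1 ≤ c →
    Σ[ G ∈ Graph ]
    ( IsFinite G
    × HasGirth G 6
    × FeedbackVertexNumberAtMost 7 G
    × Treewidth≤Pathwidth G
    × PathwidthAtMost 8 G
    × ¬ (Σ[ φ ∈ Colouring 2 G ] HasClustering G φ c) )
proposition16 c _ = G , finite , girth-six c , feedback , treewidth≤pathwidth G , pathwidth , unclusterable c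
  where open Blocks 7 (2 ^ 7 * copies c) c (anchor c) (anchor-injective c)
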